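{- Let $r\ge2$ be an integer. If a sequence of positive integers $A$ satisfies $A(n)\le\frac{r-1}{140}(\log_2 n)^2$ for all sufficiently large $n$, then $A$ is not $r$-Ramsey complete.
   Context: $A(n)=|A\cap[n]|$ is the number of terms of $A$ that are at most $n$. For a sequence $S$ of positive integers, $\Sigma(S)$ is the set of sums of distinct terms of $S$. A sequence $A$ is $r$-Ramsey complete if, whenever $A$ is partitioned into $r$ classes $A_1,\dots,A_r$, every sufficiently large positive integer lies in $\bigcup_{i}\Sigma(A_i)$. -}

module Defs where

open import Level using (0ℓ)
open import Data.Fin using (Fin)
open import Data.List using (List; length; filter; map; upTo; sum)
open import Data.List.Relation.Unary.All using (All)
open import Data.List.Relation.Unary.Unique.Propositional using (Unique)
open import Data.Nat using (ℕ; suc; _*_; _^_; _≤_; _<_)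
open import Data.Product using (_×_; ∃-syntax)
open import Relation.Binary.PropositionalEquality using (_≡_; _≢_)
open import Relation.Unary using (Pred; Decidable; _∈_; _≐_; _⊥_; ⋃)

-- A(n) = |A ∩ [n]|, where [n] = {1, …, n}.
count : {A : Pred ℕ 0ℓ} → Decidable A → ℕ → ℕ
count A? n = length (filter A? (map suc (upTo n)))

Σ⟨_⟩ : Pred ℕ 0ℓ → Pred ℕ 0ℓ
Σ⟨ S ⟩ n = ∃[ xs ] Unique xs × All S xs × sum xs ≡ n

-- Classes are allowed to be empty.
record IsPartition {r : ℕ} (A : Pred ℕ 0ℓ) (P : Fin r → Pred ℕ 0ℓ) : Set where
  field
    cover    : A ≐ ⋃ (Fin r) P
    disjoint : ∀ i j → i ≢ j → P i ⊥ P j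

RamseyComplete : ℕ → Pred ℕ 0ℓ → Set₁
RamseyComplete r A =
  (P : Fin r → Pred ℕ 0ℓ) → IsPartition A P →
  ∃[ N ] ∀ n → N ≤ n → n ∈ ⋃ (Fin r) (λ i → Σ⟨ P i ⟩)

-- For q > 0 and n > 0: the real number log₂ n is at most p / q.
log₂_≤_/_ : ℕ → ℕ → ℕ → Set
log₂ n ≤ p / q = n ^ q ≤ 2 ^ p

-- For d > 0 and n > 0: the real inequality  x ≤ (c / d) · (log₂ n)².
-- The real number log₂ n ≥ 0 is given by its upper Dedekind cut: it is the
-- infimum of the rationals p / q ≥ log₂ n, so by continuity of squaring the
-- inequality holds iff x ≤ (c / d) · (p / q)² for every such p / q.
_≤_/_·[log₂_]² : ℕ → ℕ → ℕ → ℕ → Set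
x ≤ c / d ·[log₂ n ]² =
  ∀ p q → 0 < q → log₂ n ≤ p / q → x * d * q ^ 2 ≤ c * p ^ 2

{-# OPTIONS --safe #-}
-- Colour A in stages. At a stage everything up to some X is already coloured, and with 2^(8k) ≫ X
-- the hypothesis gives |A ∩ [2^(8k)]| ≤ h k², h = ⌊r/2⌋. An element of A at distance d (in powers
-- of two) from a threshold u = 2^s gets weight about 2^(-d); summing over s shows that for some
-- 5k ≤ s < 7k the total weight is at most 2hk. Elements between X and u are spread evenly over the
-- first h colours, whose sums then stay below (2k+2)u. Elements from u on are spread evenly over the
-- next h colours; by Rankin's trick each of these has at most 2^(4k+3) subset sums below (2k+3)u.
-- Since u ≥ 2^(5k), even after the bounded contribution of the elements up to X some n in
-- [(2k+2)u, (2k+3)u) is not a sum in any colour. Repeating with X = n yields infinitely many such n.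
module Submission where

open import Defs
open import Level using (0ℓ)
open import Data.Bool using (if_then_else_)
open import Data.Fin using (toℕ; fromℕ<)
open import Data.Fin.Properties using (toℕ-fromℕ<; toℕ-injective; toℕ<n)
open import Data.List using (List; []; _∷_; _++_; [_]; length; map; upTo; filter; concatMap; applyUpTo)
open import Data.List.Membership.Propositional using () renaming (_∈_ to _∈ₗ_; _∉_ to _∉ₗ_)
open import Data.List.Membership.Propositional.Properties using (∈-++⁺ˡ; ∈-++⁺ʳ; ∈-map⁺; ∈-upTo⁺; ∈-applyUpTo⁺; ∈-concat⁺′)
open import Data.List.Properties using (length-++; length-map; length-upTo; length-applyUpTo; upTo-∷ʳ; map-++; filter-++)
open import Data.List.Relation.Unary.All as All using (All; []; _∷_)
open import Data.List.Relation.Unary.AllPairs using ([]; _∷_)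
open import Data.List.Relation.Unary.Any using (here; there)
open import Data.List.Relation.Unary.Unique.Propositional using (Unique)
open import Data.Nat using (ℕ; zero; suc; _+_; _*_; _^_; _∸_; _≤_; _<_; z≤n; s≤s; s≤s⁻¹; NonZero; >-nonZero)
open import Data.Nat.ListAction using (sum)
open import Data.Nat.Properties
open import Data.List.Membership.DecPropositional _≟_ using (_∈?_)
open import Data.Nat.Tactic.RingSolver using (solve-∀)
open import Data.Product using (Σ-syntax; ∃-syntax; _×_; _,_; proj₁; proj₂)
open import Data.Sum using (inj₁; inj₂)
open import Function using (_∘_)
open import Relation.Binary.PropositionalEquality using (_≡_; _≢_; refl; sym; trans; cong; cong₂; subst; module ≡-Reasoning)
open import Relation.Nullary using (¬_; Dec; yes; no; does; contradiction; _×-dec_)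
open import Relation.Unary using (Pred; Decidable; _∈_)

-- Finite sums over initial segments with indicator terms.

when : {P : Set} → Dec P → ℕ → ℕ
when d x = if does d then x else 0

when-yes : {P : Set} (d : Dec P) {x : ℕ} → P → when d x ≡ x
when-yes (yes _) _ = refl
when-yes (no ¬p) p = contradiction p ¬p

when-no : {P : Set} (d : Dec P) {x : ℕ} → ¬ P → when d x ≡ 0
when-no (yes p) ¬p = contradiction p ¬p
when-no (no _)  _  = refl

when-≤ : {P : Set} (d : Dec P) {x : ℕ} → when d x ≤ x
when-≤ (yes _) = ≤-refl
when-≤ (no _)  = z≤n

when-mono-≤ : {P : Set} (d : Dec P) {x y : ℕ} → (P → x ≤ y) → when d x ≤ when d y
when-mono-≤ (yes p) x≤y = x≤y p
when-mono-≤ (no _)  _   = z≤n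

when-*ʳ : {P : Set} (d : Dec P) (x y : ℕ) → when d x * y ≡ when d (x * y)
when-*ʳ (yes _) x y = refl
when-*ʳ (no _)  x y = refl

when-× : {P Q : Set} (d : Dec P) (e : Dec Q) (x : ℕ) → when (d ×-dec e) x ≡ when d (when e x)
when-× (yes _) (yes _) x = refl
when-× (yes _) (no _)  x = refl
when-× (no _)  e       x = refl

Σ< : ℕ → (ℕ → ℕ) → ℕ
Σ< zero    f = 0
Σ< (suc n) f = Σ< n f + f n

Σ<-mono : ∀ n {f g : ℕ → ℕ} → (∀ i → i < n → f i ≤ g i) → Σ< n f ≤ Σ< n g
Σ<-mono zero    f≤g = z≤n
Σ<-mono (suc n) f≤g = +-mono-≤ (Σ<-mono n λ i i<n → f≤g i (m<n⇒m<1+n i<n)) (f≤g n ≤-refl)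

Σ<-cong : ∀ n {f g : ℕ → ℕ} → (∀ i → i < n → f i ≡ g i) → Σ< n f ≡ Σ< n g
Σ<-cong zero    f≡g = refl
Σ<-cong (suc n) f≡g = cong₂ _+_ (Σ<-cong n λ i i<n → f≡g i (m<n⇒m<1+n i<n)) (f≡g n ≤-refl)

Σ<-const : ∀ n c → Σ< n (λ _ → c) ≡ n * c
Σ<-const zero    c = refl
Σ<-const (suc n) c = trans (cong (_+ c) (Σ<-const n c)) (+-comm (n * c) c)

Σ<-0 : ∀ n → Σ< n (λ _ → 0) ≡ 0
Σ<-0 n = trans (Σ<-const n 0) (*-zeroʳ n)

Σ<-+ : ∀ n (f g : ℕ → ℕ) → Σ< n (λ i → f i + g i) ≡ Σ< n f + Σ< n g
Σ<-+ zero    f g = refl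
Σ<-+ (suc n) f g = trans (cong (_+ (f n + g n)) (Σ<-+ n f g)) (+-interchange (Σ< n f) (Σ< n g) (f n) (g n))
  where
  +-interchange : ∀ a b c d → (a + b) + (c + d) ≡ (a + c) + (b + d)
  +-interchange = solve-∀

Σ<-*ʳ : ∀ n (f : ℕ → ℕ) c → Σ< n (λ i → f i * c) ≡ Σ< n f * c
Σ<-*ʳ zero    f c = refl
Σ<-*ʳ (suc n) f c = trans (cong (_+ f n * c) (Σ<-*ʳ n f c)) (sym (*-distribʳ-+ c (Σ< n f) (f n)))

Σ<-swap : ∀ m n (f : ℕ → ℕ → ℕ) → Σ< m (λ i → Σ< n (f i)) ≡ Σ< n (λ j → Σ< m (λ i → f i j))
Σ<-swap zero    n f = sym (Σ<-0 n)
Σ<-swap (suc m) n f = trans (cong (_+ Σ< n (f m)) (Σ<-swap m n f)) (sym (Σ<-+ n _ (f m)))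

Σ<-extend : ∀ {m n} (f : ℕ → ℕ) → m ≤ n → Σ< m f ≤ Σ< n f
Σ<-extend {n = zero}  f z≤n = z≤n
Σ<-extend {m} {suc n} f m≤1+n with m≤n⇒m<n∨m≡n m≤1+n
... | inj₁ (s≤s m≤n) = ≤-trans (Σ<-extend f m≤n) (m≤m+n _ _)
... | inj₂ refl      = ≤-refl

-- No order between `m` and `n` is assumed: terms from `n` on vanish, and below `n` the sum can only
-- grow.
Σ<-support : ∀ m n (f : ℕ → ℕ) → (∀ i → n ≤ i → f i ≡ 0) → Σ< m f ≤ Σ< n f
Σ<-support zero    n f f≡0 = z≤n
Σ<-support (suc m) n f f≡0 with n ≤? m
... | yes n≤m = subst (λ x → Σ< m f + x ≤ Σ< n f) (sym (f≡0 m n≤m))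
                  (subst (_≤ Σ< n f) (sym (+-identityʳ _)) (Σ<-support m n f f≡0))
... | no  n≰m = Σ<-extend f (≰⇒> n≰m)

Σ<-single-≤ : ∀ n x y → Σ< n (λ i → when (x ≟ i) y) ≤ y
Σ<-single-≤ zero    x y = z≤n
Σ<-single-≤ (suc n) x y with x ≟ n
... | no  x≢n = subst (λ z → Σ< n (λ i → when (x ≟ i) y) + z ≤ y) (sym (when-no (x ≟ n) x≢n))
                  (subst (_≤ y) (sym (+-identityʳ _)) (Σ<-single-≤ n x y))
... | yes refl = +-mono-≤ {v = y} (≤-reflexive vanish) (when-≤ (x ≟ x))
  where
  vanish : Σ< n (λ i → when (n ≟ i) y) ≡ 0
  vanish = trans (Σ<-cong n λ i i<n → when-no (n ≟ i) (<⇒≢ i<n ∘ sym)) (Σ<-0 n)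

Σ<-single : ∀ {n x} y → x < n → Σ< n (λ i → when (x ≟ i) y) ≡ y
Σ<-single {n} {x} y x<n = ≤-antisym (Σ<-single-≤ n x y) (begin
  y                                  ≡⟨ when-yes (x ≟ x) refl ⟨
  when (x ≟ x) y                     ≤⟨ m≤n+m _ _ ⟩
  Σ< (suc x) (λ i → when (x ≟ i) y)  ≤⟨ Σ<-extend _ x<n ⟩
  Σ< n (λ i → when (x ≟ i) y)        ∎)
  where open ≤-Reasoning

-- Averaging and greedy balancing.

-- If all `n` values were at least `suc B`, the sum would reach `n * suc B`. This averaging selects
-- a bin, a missed target and a scale below.
Σ<-pigeonhole : ∀ n (f : ℕ → ℕ) B → Σ< n f < n * suc B → ∃[ i ] i < n × f i ≤ B
Σ<-pigeonhole (suc n) f B lt with f n ≤? B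
... | yes fn≤B = n , ≤-refl , fn≤B
... | no  fn≰B = let i , i<n , fi≤B = Σ<-pigeonhole n f B small in i , m<n⇒m<1+n i<n , fi≤B
  where
  open ≤-Reasoning
  small : Σ< n f < n * suc B
  small = +-cancelʳ-< (suc B) _ _ (begin-strict
    Σ< n f + suc B   ≤⟨ +-monoʳ-≤ (Σ< n f) (≰⇒> fn≰B) ⟩
    Σ< n f + f n     <⟨ lt ⟩
    suc B + n * suc B ≡⟨ +-comm (suc B) _ ⟩
    n * suc B + suc B ∎)

update : (ℕ → ℕ) → ℕ → ℕ → ℕ → ℕ
update f n y a with a ≟ n
... | yes _ = y
... | no  _ = f a

update-≡ : ∀ f n y → update f n y n ≡ y
update-≡ f n y with n ≟ n
... | yes _  = refl
... | no n≢n = contradiction refl n≢n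

update-≢ : ∀ f n y {a} → a ≢ n → update f n y a ≡ f a
update-≢ f n y {a} a≢n with a ≟ n
... | yes a≡n = contradiction a≡n a≢n
... | no _    = refl

update-< : ∀ f n y {h} → y < h → (∀ a → f a < h) → ∀ a → update f n y a < h
update-< f n y y<h f<h a with a ≟ n
... | yes _ = y<h
... | no _  = f<h a

-- Greedy bin packing: some bin always has load at most B.
balance : ∀ h B W M (v : ℕ → ℕ) → 0 < h → (∀ a → a < M → v a ≤ W) → Σ< M v ≤ h * B →
  ∃[ f ] (∀ a → f a < h) × (∀ i → Σ< M (λ a → when (f a ≟ i) (v a)) ≤ B + W)
balance h B W zero    v 0<h v≤W total = (λ _ → 0) , (λ _ → 0<h) , λ _ → z≤n
balance h B W (suc M) v 0<h v≤W total
  with balance h B W M v 0<h (λ a a<M → v≤W a (m<n⇒m<1+n a<M)) (≤-trans (m≤m+n _ _) total)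
... | f , f<h , loads
  with Σ<-pigeonhole h (λ i → Σ< M (λ a → when (f a ≟ i) (v a))) B (begin-strict
         Σ< h (λ i → Σ< M (λ a → when (f a ≟ i) (v a)))  ≡⟨ Σ<-swap h M _ ⟩
         Σ< M (λ a → Σ< h (λ i → when (f a ≟ i) (v a)))  ≤⟨ Σ<-mono M (λ a _ → Σ<-single-≤ h (f a) (v a)) ⟩
         Σ< M v                                          ≤⟨ ≤-trans (m≤m+n _ _) total ⟩
         h * B                                           <⟨ *-monoʳ-< h {{>-nonZero 0<h}} (n<1+n B) ⟩
         h * suc B                                       ∎)
  where open ≤-Reasoning
... | k , k<h , room = g , update-< f M k k<h f<h , loads′
  where
  g : ℕ → ℕ
  g = update f M k
  old : ∀ i → Σ< M (λ a → when (g a ≟ i) (v a)) ≡ Σ< M (λ a → when (f a ≟ i) (v a))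
  old i = Σ<-cong M λ a a<M → cong (λ c → when (c ≟ i) (v a)) (update-≢ f M k (<⇒≢ a<M))
  loads′ : ∀ i → Σ< (suc M) (λ a → when (g a ≟ i) (v a)) ≤ B + W
  loads′ i with k ≟ i
  ... | yes refl = +-mono-≤ (≤-trans (≤-reflexive (old i)) room) (≤-trans (when-≤ (g M ≟ i)) (v≤W M ≤-refl))
  ... | no  k≢i  = begin
    Σ< M (λ a → when (g a ≟ i) (v a)) + when (g M ≟ i) (v M)
      ≡⟨ cong₂ _+_ (old i) (when-no (g M ≟ i) λ gM≡i → k≢i (trans (sym (update-≡ f M k)) gM≡i)) ⟩
    Σ< M (λ a → when (f a ≟ i) (v a)) + 0  ≡⟨ +-identityʳ _ ⟩
    Σ< M (λ a → when (f a ≟ i) (v a))      ≤⟨ loads i ⟩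
    B + W                                  ∎
    where open ≤-Reasoning

-- Values missed by short lists; subset sums and counts as indicator sums.

-- Each entry of `ys` hits at most one of the `u` candidates, so the multiplicities sum to less than
-- `u` and the pigeonhole with bound 0 finds a candidate of multiplicity 0.
∃-∉ : ∀ lo u (ys : List ℕ) → length ys < u → ∃[ n ] lo ≤ n × n < lo + u × n ∉ₗ ys
∃-∉ lo u ys short =
  let i , i<u , none = Σ<-pigeonhole u (λ i → mult ys (lo + i)) 0
                         (<-≤-trans (≤-<-trans (total ys) short) (≤-reflexive (sym (*-identityʳ u))))
  in lo + i , m≤m+n lo i , +-monoʳ-< lo i<u , λ mem → <⇒≱ (mult-∈ ys mem) none
  where
  mult : List ℕ → ℕ → ℕ
  mult []       n = 0
  mult (y ∷ ys) n = when (y ≟ n) 1 + mult ys n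
  mult-∈ : ∀ ys {n} → n ∈ₗ ys → 0 < mult ys n
  mult-∈ (y ∷ ys) {n} (here n≡y) = ≤-trans (≤-reflexive (sym (when-yes (y ≟ n) (sym n≡y)))) (m≤m+n _ _)
  mult-∈ (y ∷ ys) {n} (there m)  = ≤-trans (mult-∈ ys m) (m≤n+m _ _)
  shift : ∀ y → Σ< u (λ i → when (y ≟ lo + i) 1) ≤ 1
  shift y with lo ≤? y
  ... | yes lo≤y = ≤-trans (Σ<-mono u λ i _ → eq i) (Σ<-single-≤ u (y ∸ lo) 1)
    where
    eq : ∀ i → when (y ≟ lo + i) 1 ≤ when (y ∸ lo ≟ i) 1
    eq i with y ≟ lo + i
    ... | yes refl = ≤-trans (when-≤ (y ≟ lo + i)) (≤-reflexive (sym (when-yes (y ∸ lo ≟ i) (m+n∸m≡n lo i))))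
    ... | no  y≢   = ≤-trans (≤-reflexive (when-no (y ≟ lo + i) y≢)) z≤n
  ... | no  lo≰y = ≤-trans (≤-reflexive (trans (Σ<-cong u λ i _ →
                     when-no (y ≟ lo + i) λ eq → lo≰y (subst (lo ≤_) (sym eq) (m≤m+n lo i))) (Σ<-0 u))) z≤n
  total : ∀ ys → Σ< u (λ i → mult ys (lo + i)) ≤ length ys
  total []       = ≤-reflexive (Σ<-0 u)
  total (y ∷ ys) = ≤-trans (≤-reflexive (Σ<-+ u _ _)) (+-mono-≤ (shift y) (total ys))

-- Distinctness ensures that membership counts every entry exactly once. In this form a subset sum
-- can be split by conditions on its terms.
sum-as-Σ< : ∀ M xs → Unique xs → All (_< M) xs → sum xs ≡ Σ< M (λ a → when (a ∈? xs) a)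
sum-as-Σ< M []       _        _          = sym (Σ<-0 M)
sum-as-Σ< M (x ∷ xs) (x∉ ∷ u) (x<M ∷ xs<M) = begin
  x + sum xs
    ≡⟨ cong₂ _+_ (sym (Σ<-single x x<M)) (sum-as-Σ< M xs u xs<M) ⟩
  Σ< M (λ a → when (x ≟ a) x) + Σ< M (λ a → when (a ∈? xs) a)
    ≡⟨ Σ<-+ M _ _ ⟨
  Σ< M (λ a → when (x ≟ a) x + when (a ∈? xs) a)
    ≡⟨ Σ<-cong M (λ a _ → split a) ⟩
  Σ< M (λ a → when (a ∈? (x ∷ xs)) a) ∎
  where
  open ≡-Reasoning
  split : ∀ a → when (x ≟ a) x + when (a ∈? xs) a ≡ when (a ∈? (x ∷ xs)) a
  split a = by-cases (x ≟ a) (a ∈? xs)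
    where
    by-cases : Dec (x ≡ a) → Dec (a ∈ₗ xs) → _
    by-cases (yes refl) (yes x∈xs) = contradiction refl (All.lookup x∉ x∈xs)
    by-cases (yes refl) (no  x∉xs) = trans (cong₂ _+_ (when-yes (x ≟ x) refl) (when-no (x ∈? xs) x∉xs))
      (trans (+-identityʳ x) (sym (when-yes (x ∈? (x ∷ xs)) (here refl))))
    by-cases (no  x≢a)  (yes a∈xs) = trans (cong₂ _+_ (when-no (x ≟ a) x≢a) (when-yes (a ∈? xs) a∈xs))
      (sym (when-yes (a ∈? (x ∷ xs)) (there a∈xs)))
    by-cases (no  x≢a)  (no  a∉xs) = trans (cong₂ _+_ (when-no (x ≟ a) x≢a) (when-no (a ∈? xs) a∉xs))
      (sym (when-no (a ∈? (x ∷ xs)) λ { (here a≡x) → x≢a (sym a≡x) ; (there a∈xs) → a∉xs a∈xs }))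

sum-∈-≤ : ∀ xs → All (_≤ sum xs) xs
sum-∈-≤ []       = []
sum-∈-≤ (x ∷ xs) = m≤m+n x _ ∷ All.map (λ le → ≤-trans le (m≤n+m _ x)) (sum-∈-≤ xs)

-- The left side starts at 0 and the right side at 1; `¬ A 0` reconciles the two ranges.
count-as-Σ< : {A : Pred ℕ 0ℓ} (A? : Decidable A) → ¬ A 0 → ∀ n →
  Σ< (suc n) (λ a → when (A? a) 1) ≡ count A? n
count-as-Σ< A? ¬A0 zero    = when-no (A? 0) ¬A0
count-as-Σ< A? ¬A0 (suc n) = begin
  Σ< (suc n) (λ a → when (A? a) 1) + when (A? (suc n)) 1
    ≡⟨ cong₂ _+_ (count-as-Σ< A? ¬A0 n) (last (suc n)) ⟩
  length (filter A? (map suc (upTo n))) + length (filter A? [ suc n ])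
    ≡⟨ length-++ (filter A? (map suc (upTo n))) ⟨
  length (filter A? (map suc (upTo n)) ++ filter A? [ suc n ])
    ≡⟨ cong length (filter-++ A? (map suc (upTo n)) [ suc n ]) ⟨
  length (filter A? (map suc (upTo n) ++ [ suc n ]))
    ≡⟨ cong (length ∘ filter A?) (map-++ suc (upTo n) [ n ]) ⟨
  length (filter A? (map suc (upTo n ++ [ n ])))
    ≡⟨ cong (length ∘ filter A? ∘ map suc) (upTo-∷ʳ n) ⟩
  length (filter A? (map suc (upTo (suc n)))) ∎
  where
  open ≡-Reasoning
  last : ∀ a → when (A? a) 1 ≡ length (filter A? [ a ])
  last a with A? a
  ... | yes _ = refl
  ... | no  _ = refl

length-concatMap-≤ : {A B : Set} (f : A → List B) (xs : List A) (c : ℕ) →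
  (∀ x → length (f x) ≤ c) → length (concatMap f xs) ≤ length xs * c
length-concatMap-≤ f []       c le = z≤n
length-concatMap-≤ f (x ∷ xs) c le =
  ≤-trans (≤-reflexive (length-++ (f x))) (+-mono-≤ (le x) (length-concatMap-≤ f xs c le))

∈-concatMap : {A B : Set} (f : A → List B) {xs : List A} {x : A} {y : B} →
  x ∈ₗ xs → y ∈ₗ f x → y ∈ₗ concatMap f xs
∈-concatMap f x∈xs y∈fx = ∈-concat⁺′ y∈fx (∈-map⁺ f x∈xs)

-- Binary logarithms and geometric series over dyadic scales.

-- The floor of the binary logarithm, with default value 0 at 0.
lg : ℕ → ℕ
lg zero = 0
lg (suc n) with suc n <? 2 ^ suc (lg n)
... | yes _ = lg n
... | no  _ = suc (lg n)

<2^1+lg : ∀ n → n < 2 ^ suc (lg n)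
<2^1+lg zero = s≤s z≤n
<2^1+lg (suc n) with suc n <? 2 ^ suc (lg n)
... | yes lt = lt
... | no  _  = begin-strict
  suc n               ≤⟨ <2^1+lg n ⟩
  2 ^ suc (lg n)      <⟨ ^-monoʳ-< 2 (s≤s (s≤s z≤n)) (n<1+n (suc (lg n))) ⟩
  2 ^ suc (suc (lg n)) ∎
  where open ≤-Reasoning

2^lg≤ : ∀ n → 0 < n → 2 ^ lg n ≤ n
2^lg≤ (suc n) _ = positive n
  where
  positive : ∀ n → 2 ^ lg (suc n) ≤ suc n
  positive zero = s≤s z≤n
  positive (suc n) with suc (suc n) <? 2 ^ suc (lg (suc n))
  ... | yes _ = m≤n⇒m≤1+n (positive n)
  ... | no ≮  = ≮⇒≥ ≮

2^-cancel-≤ : ∀ {m n} → 2 ^ m ≤ 2 ^ n → m ≤ n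
2^-cancel-≤ {m} {n} le with m ≤? n
... | yes m≤n = m≤n
... | no  m≰n = contradiction le (<⇒≱ (^-monoʳ-< 2 (s≤s (s≤s z≤n)) (≰⇒> m≰n)))

lg-≤ : ∀ {D} a → a ≤ 2 ^ D → lg a ≤ D
lg-≤ zero    _  = z≤n
lg-≤ (suc a) le = 2^-cancel-≤ (≤-trans (2^lg≤ (suc a) (s≤s z≤n)) le)

≤lg : ∀ s a → 2 ^ s ≤ a → s ≤ lg a
≤lg s a le with s ≤? lg a
... | yes p = p
... | no ¬p = contradiction (≤-<-trans (≤-trans (^-monoʳ-≤ 2 (≰⇒> ¬p)) le) (<2^1+lg a)) (<-irrefl refl)

n<2^n : ∀ n → n < 2 ^ n
n<2^n zero    = s≤s z≤n
n<2^n (suc n) = begin-strict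
  suc n            <⟨ s≤s (n<2^n n) ⟩
  1 + 2 ^ n        ≤⟨ +-monoˡ-≤ (2 ^ n) (m^n>0 2 n) ⟩
  2 ^ n + 2 ^ n    ≡⟨ cong (2 ^ n +_) (+-identityʳ _) ⟨
  2 ^ suc n        ∎
  where open ≤-Reasoning

-- The weight 2^s / 2^⌊log₂ a⌋ of an element a ≥ 2^s, scaled by 2^D to be an integer.
cost : ℕ → ℕ → ℕ → ℕ
cost D s a = 2 ^ (D ∸ (lg a ∸ s))

-- With `t = lg a` this makes the exponent in `cost` linear in `s`, so that the costs of a fixed `a`
-- double from one scale to the next.
∸-∸-+ : ∀ {D t s} → s ≤ t → t ≤ D → D ∸ (t ∸ s) ≡ (D ∸ t) + s
∸-∸-+ {D} {t} {s} s≤t t≤D = begin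
  D ∸ (t ∸ s)                      ≡⟨ cong (_∸ (t ∸ s)) (m∸n+n≡m t≤D) ⟨
  (D ∸ t + t) ∸ (t ∸ s)            ≡⟨ cong (λ x → (D ∸ t + x) ∸ (t ∸ s)) (m∸n+n≡m s≤t) ⟨
  (D ∸ t + (t ∸ s + s)) ∸ (t ∸ s)  ≡⟨ cong (λ x → (D ∸ t + x) ∸ (t ∸ s)) (+-comm (t ∸ s) s) ⟩
  (D ∸ t + (s + (t ∸ s))) ∸ (t ∸ s) ≡⟨ cong (_∸ (t ∸ s)) (+-assoc (D ∸ t) s (t ∸ s)) ⟨
  (D ∸ t + s + (t ∸ s)) ∸ (t ∸ s)  ≡⟨ m+n∸n≡m (D ∸ t + s) (t ∸ s) ⟩
  D ∸ t + s                        ∎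
  where open ≡-Reasoning

Σ<-geometric : ∀ n e (f : ℕ → ℕ) → (∀ i → i < n → f i ≤ 2 ^ (e + i)) → Σ< n f ≤ 2 ^ (e + n)
Σ<-geometric zero    e f le = z≤n
Σ<-geometric (suc n) e f le = begin
  Σ< n f + f n               ≤⟨ +-mono-≤ (Σ<-geometric n e f λ i i<n → le i (m<n⇒m<1+n i<n)) (le n ≤-refl) ⟩
  2 ^ (e + n) + 2 ^ (e + n)  ≡⟨ cong (2 ^ (e + n) +_) (+-identityʳ _) ⟨
  2 ^ suc (e + n)            ≡⟨ cong (2 ^_) (+-suc e n) ⟨
  2 ^ (e + suc n)            ∎
  where open ≤-Reasoning

-- Only scales `s ≤ lg a` count. Over these the cost doubles at each step and ends at `2 ^ D`, so
-- the geometric series stays below twice its last term.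
Σ<-cost : ∀ D n a → 0 < a → a ≤ 2 ^ D →
  Σ< n (λ s → when (2 ^ s ≤? a) (cost D s a)) ≤ 2 * 2 ^ D
Σ<-cost D n a 0<a a≤2^D = begin
  Σ< n f                 ≤⟨ Σ<-support n (suc t) f (λ s t<s → when-no (2 ^ s ≤? a) λ le → <⇒≱ t<s (≤lg s a le)) ⟩
  Σ< (suc t) f           ≤⟨ Σ<-geometric (suc t) (D ∸ t) f term ⟩
  2 ^ (D ∸ t + suc t)    ≡⟨ cong (2 ^_) (trans (+-suc (D ∸ t) t) (cong suc (m∸n+n≡m t≤D))) ⟩
  2 * 2 ^ D              ∎
  where
  open ≤-Reasoning
  t = lg a
  f : ℕ → ℕ
  f s = when (2 ^ s ≤? a) (cost D s a)
  t≤D : t ≤ D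
  t≤D = lg-≤ a a≤2^D
  term : ∀ s → s < suc t → f s ≤ 2 ^ (D ∸ t + s)
  term s (s≤s s≤t) = ≤-trans (when-≤ (2 ^ s ≤? a)) (≤-reflexive (cong (2 ^_) (∸-∸-+ s≤t t≤D)))

-- The extra summand is the tail of the geometric series, which makes the induction telescope.
Σ<-size-tail : ∀ D a n → 0 < a → lg a < n → n ≤ suc D →
  Σ< n (λ s → when (a <? 2 ^ s) (a * 2 ^ (D ∸ s))) + a * 2 ^ (suc D ∸ n) ≤ 2 * 2 ^ D
Σ<-size-tail D a (suc n) 0<a (s≤s t≤n) (s≤s n≤D) with m≤n⇒m<n∨m≡n t≤n
... | inj₁ t<n = begin
  Σ< n f + f n + a * 2 ^ (D ∸ n)               ≡⟨ +-assoc (Σ< n f) (f n) _ ⟩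
  Σ< n f + (f n + a * 2 ^ (D ∸ n))             ≤⟨ +-monoʳ-≤ (Σ< n f) (+-monoˡ-≤ _ (when-≤ (a <? 2 ^ n))) ⟩
  Σ< n f + (a * 2 ^ (D ∸ n) + a * 2 ^ (D ∸ n)) ≡⟨ cong (Σ< n f +_) (double a (2 ^ (D ∸ n))) ⟩
  Σ< n f + a * 2 ^ suc (D ∸ n)                 ≡⟨ cong (λ e → Σ< n f + a * 2 ^ e) (+-∸-assoc 1 n≤D) ⟨
  Σ< n f + a * 2 ^ (suc D ∸ n)                 ≤⟨ Σ<-size-tail D a n 0<a t<n (m≤n⇒m≤1+n n≤D) ⟩
  2 * 2 ^ D                                    ∎
  where
  open ≤-Reasoning
  f : ℕ → ℕ
  f s = when (a <? 2 ^ s) (a * 2 ^ (D ∸ s))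
  double : ∀ x y → x * y + x * y ≡ x * (2 * y)
  double = solve-∀
-- At `n = lg a + 1` no scale exceeds `lg a`, so every summand is zero; the tail alone is bounded
-- through `a < 2 ^ suc (lg a)`.
... | inj₂ refl = begin
  Σ< (suc t) f + a * 2 ^ (D ∸ t)  ≡⟨ cong (_+ a * 2 ^ (D ∸ t)) vanish ⟩
  a * 2 ^ (D ∸ t)                 ≤⟨ *-monoˡ-≤ (2 ^ (D ∸ t)) (<⇒≤ (<2^1+lg a)) ⟩
  2 * 2 ^ t * 2 ^ (D ∸ t)         ≡⟨ *-assoc 2 (2 ^ t) _ ⟩
  2 * (2 ^ t * 2 ^ (D ∸ t))       ≡⟨ cong (2 *_) (^-distribˡ-+-* 2 t (D ∸ t)) ⟨
  2 * 2 ^ (t + (D ∸ t))           ≡⟨ cong (λ e → 2 * 2 ^ e) (m+[n∸m]≡n n≤D) ⟩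
  2 * 2 ^ D                       ∎
  where
  open ≤-Reasoning
  t = lg a
  f : ℕ → ℕ
  f s = when (a <? 2 ^ s) (a * 2 ^ (D ∸ s))
  vanish : Σ< (suc t) f ≡ 0
  vanish = trans (Σ<-cong (suc t) λ { s (s≤s s≤t) → when-no (a <? 2 ^ s)
                   (≤⇒≯ (≤-trans (^-monoʳ-≤ 2 s≤t) (2^lg≤ a 0<a))) }) (Σ<-0 (suc t))

-- The counterpart of `Σ<-cost` above `a`: the scaled ratio of `a` to `2 ^ s` halves at each scale
-- after `lg a`, starting below `2 ^ D`.
Σ<-size : ∀ D n a → 0 < a → a ≤ 2 ^ D → n ≤ suc D →
  Σ< n (λ s → when (a <? 2 ^ s) (a * 2 ^ (D ∸ s))) ≤ 2 * 2 ^ D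
Σ<-size D n a 0<a a≤2^D n≤1+D =
  ≤-trans (Σ<-extend _ n≤1+D) (≤-trans (m≤m+n _ _) (Σ<-size-tail D a (suc D) 0<a (s≤s t≤D) ≤-refl))
  where
  t≤D : lg a ≤ D
  t≤D = lg-≤ a a≤2^D

Σ<-shift : ∀ m n (f : ℕ → ℕ) → Σ< n (λ i → f (m + i)) ≤ Σ< (m + n) f
Σ<-shift m zero    f = z≤n
Σ<-shift m (suc n) f = subst (λ k → Σ< n (λ i → f (m + i)) + f (m + n) ≤ Σ< k f) (sym (+-suc m n))
                         (+-monoˡ-≤ (f (m + n)) (Σ<-shift m n f))

-- An integer form of (1 + 2^(-w))^w ≤ 2 for w a power of two.

2j≤2^j : ∀ j → 2 * j ≤ 2 ^ j
2j≤2^j zero    = z≤n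
2j≤2^j (suc j) = *-monoʳ-≤ 2 (n<2^n j)

square-^ : ∀ x n → x ^ (2 * n) ≡ (x * x) ^ n
square-^ x n = trans (sym (^-*-assoc x 2 n)) (cong (_^ n) (cong (x *_) (*-identityʳ x)))

[m*n]^k : ∀ m n k → (m * n) ^ k ≡ m ^ k * n ^ k
[m*n]^k m n zero    = refl
[m*n]^k m n (suc k) = trans (cong (m * n *_) ([m*n]^k m n k)) (interchange m n (m ^ k) (n ^ k))
  where
  interchange : ∀ a b c d → a * b * (c * d) ≡ a * c * (b * d)
  interchange = solve-∀

-- With x = 4^j v this says (1 + 1/x)^(2^j) ≤ 1 + 1/v; each step is (1 + 1/4x)² ≤ 1 + 1/x.
bernoulli : ∀ j v → 0 < v → (4 ^ j * v + 1) ^ (2 ^ j) * v ≤ (4 ^ j * v) ^ (2 ^ j) * (v + 1)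
bernoulli zero    v 0<v = ≤-reflexive (base v)
  where
  base : ∀ v → ((v + 0) + 1) * 1 * v ≡ (v + 0) * 1 * (v + 1)
  base = solve-∀
bernoulli (suc j) v 0<v = begin
  (4 * 4 ^ j * v + 1) ^ (2 * n) * v        ≡⟨ cong (λ y → (y + 1) ^ (2 * n) * v) (*-assoc 4 (4 ^ j) v) ⟩
  (4 * x + 1) ^ (2 * n) * v                ≡⟨ cong (_* v) (square-^ (4 * x + 1) n) ⟩
  ((4 * x + 1) * (4 * x + 1)) ^ n * v      ≤⟨ *-monoˡ-≤ v (^-monoˡ-≤ n step) ⟩
  (16 * x * (x + 1)) ^ n * v               ≡⟨ cong (_* v) ([m*n]^k (16 * x) (x + 1) n) ⟩
  (16 * x) ^ n * (x + 1) ^ n * v           ≡⟨ *-assoc ((16 * x) ^ n) _ v ⟩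
  (16 * x) ^ n * ((x + 1) ^ n * v)         ≤⟨ *-monoʳ-≤ ((16 * x) ^ n) (bernoulli j v 0<v) ⟩
  (16 * x) ^ n * (x ^ n * (v + 1))         ≡⟨ *-assoc ((16 * x) ^ n) _ _ ⟨
  (16 * x) ^ n * x ^ n * (v + 1)           ≡⟨ cong (_* (v + 1)) ([m*n]^k (16 * x) x n) ⟨
  (16 * x * x) ^ n * (v + 1)               ≡⟨ cong (λ y → y ^ n * (v + 1)) (regroup x) ⟩
  ((4 * x) * (4 * x)) ^ n * (v + 1)        ≡⟨ cong (_* (v + 1)) (square-^ (4 * x) n) ⟨
  (4 * x) ^ (2 * n) * (v + 1)              ≡⟨ cong (λ y → y ^ (2 * n) * (v + 1)) (*-assoc 4 (4 ^ j) v) ⟨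
  (4 * 4 ^ j * v) ^ (2 * n) * (v + 1)      ∎
  where
  open ≤-Reasoning
  n = 2 ^ j
  x = 4 ^ j * v
  regroup : ∀ x → 16 * x * x ≡ (4 * x) * (4 * x)
  regroup = solve-∀
  lhs : ∀ x → (4 * x + 1) * (4 * x + 1) ≡ 16 * x * x + 8 * x + 1
  lhs = solve-∀
  rhs : ∀ x → 16 * x * (x + 1) ≡ 16 * x * x + 8 * x + 8 * x
  rhs = solve-∀
  0<x : 0 < x
  0<x = *-mono-≤ (m^n>0 4 j) 0<v
  step : (4 * x + 1) * (4 * x + 1) ≤ 16 * x * (x + 1)
  step = begin
    (4 * x + 1) * (4 * x + 1)    ≡⟨ lhs x ⟩
    16 * x * x + 8 * x + 1       ≤⟨ +-monoʳ-≤ (16 * x * x + 8 * x) (≤-trans 0<x (m≤n*m x 8)) ⟩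
    16 * x * x + 8 * x + 8 * x   ≡⟨ rhs x ⟨
    16 * x * (x + 1)             ∎

-- Divided by the power on the right, this is (1 + 2^(-w))^w ≤ 2 with w = 2^j. It follows from
-- `bernoulli` because 1 + 1/v ≤ 2.
[2^w+1]^w≤ : ∀ j → (2 ^ (2 ^ j) + 1) ^ (2 ^ j) ≤ 2 * (2 ^ (2 ^ j)) ^ (2 ^ j)
[2^w+1]^w≤ j = subst (λ x → (x + 1) ^ (2 ^ j) ≤ 2 * x ^ (2 ^ j)) x≡ (*-cancelʳ-≤ _ _ v {{>-nonZero 0<v}} (begin
  (4 ^ j * v + 1) ^ (2 ^ j) * v       ≤⟨ bernoulli j v 0<v ⟩
  (4 ^ j * v) ^ (2 ^ j) * (v + 1)     ≤⟨ *-monoʳ-≤ ((4 ^ j * v) ^ (2 ^ j)) (+-monoʳ-≤ v 0<v) ⟩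
  (4 ^ j * v) ^ (2 ^ j) * (v + v)     ≡⟨ double ((4 ^ j * v) ^ (2 ^ j)) v ⟩
  2 * (4 ^ j * v) ^ (2 ^ j) * v       ∎))
  where
  open ≤-Reasoning
  -- Chosen so that `4 ^ j * v` equals `2 ^ (2 ^ j)`; the subtraction is exact by `2j≤2^j`.
  v = 2 ^ (2 ^ j ∸ 2 * j)
  0<v : 0 < v
  0<v = m^n>0 2 (2 ^ j ∸ 2 * j)
  double : ∀ y v → y * (v + v) ≡ 2 * y * v
  double = solve-∀
  x≡ : 4 ^ j * v ≡ 2 ^ (2 ^ j)
  x≡ = trans (cong (_* v) (^-*-assoc 2 2 j))
         (trans (sym (^-distribˡ-+-* 2 (2 * j) _)) (cong (2 ^_) (m+[n∸m]≡n (2j≤2^j j))))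

^-cancelˡ-≤ : ∀ n .{{_ : NonZero n}} {x y} → x ^ n ≤ y ^ n → x ≤ y
^-cancelˡ-≤ n {x} {y} le with x ≤? y
... | yes x≤y = x≤y
... | no  x≰y = contradiction le (<⇒≱ (^-monoˡ-< n (≰⇒> x≰y)))

-- Counting subset sums of bounded weight.

module SubsetSums {L : ℕ → Set} (L? : ∀ a → Dec (L a)) (j : ℕ → ℕ) where

  w : ℕ → ℕ
  w a = 2 ^ j a

  -- Sums of sets of elements of `L` below `M` whose total weight is at most `K`, with repetitions.
  -- The length therefore bounds the number of distinct values.
  sums : ℕ → ℕ → List ℕ
  sums zero    K = [ 0 ]
  sums (suc M) K with L? M | w M ≤? K
  ... | yes _ | yes _ = sums M K ++ map (M +_) (sums M (K ∸ w M))
  ... | yes _ | no  _ = sums M K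
  ... | no  _ | _     = sums M K

  ∈-sums-skip : ∀ M K {y} → y ∈ₗ sums M K → y ∈ₗ sums (suc M) K
  ∈-sums-skip M K y∈ with L? M | w M ≤? K
  ... | yes _ | yes _ = ∈-++⁺ˡ y∈
  ... | yes _ | no  _ = y∈
  ... | no  _ | _     = y∈

  ∈-sums-take : ∀ M K {y} → L M → w M ≤ K → y ∈ₗ sums M (K ∸ w M) → M + y ∈ₗ sums (suc M) K
  ∈-sums-take M K l w≤K y∈ with L? M | w M ≤? K
  ... | yes _ | yes _  = ∈-++⁺ʳ (sums M K) (∈-map⁺ (M +_) y∈)
  ... | yes _ | no w≰K = contradiction w≤K w≰K
  ... | no ¬l | _      = contradiction l ¬l

  -- Completeness of the enumeration: each element of `R` pays its weight out of the budget `K`.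
  ∈-sums : {R : ℕ → Set} (R? : ∀ a → Dec (R a)) → (∀ a → R a → L a) → ∀ M K →
    Σ< M (λ a → when (R? a) (w a)) ≤ K → Σ< M (λ a → when (R? a) a) ∈ₗ sums M K
  ∈-sums R? R⊆L zero    K le = here refl
  ∈-sums R? R⊆L (suc M) K le with R? M
  ... | yes r = subst (_∈ₗ sums (suc M) K) (+-comm M _)
                  (∈-sums-take M K (R⊆L M r) (≤-trans (m≤n+m (w M) _) le)
                    (∈-sums R? R⊆L M (K ∸ w M) (m+n≤o⇒m≤o∸n _ le)))
  ... | no _  = subst (_∈ₗ sums (suc M) K) (sym (+-identityʳ _))
                  (∈-sums-skip M K (∈-sums R? R⊆L M K (subst (_≤ K) (+-identityʳ _) le)))

  W : ℕ → ℕ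
  W M = Σ< M (λ a → when (L? a) (w a))

  -- The product of 1 + 2^(-w) over the elements of `L` below `M`, multiplied by `2 ^ W M` to remain
  -- an integer.
  Q : ℕ → ℕ
  Q zero    = 1
  Q (suc M) with L? M
  ... | yes _ = Q M * (2 ^ w M + 1)
  ... | no  _ = Q M

  -- Rankin's trick: comparing the generating function ∏ (1 + x^w) at x = 1/2 with x^K.
  length-sums-Q : ∀ M K → length (sums M K) * 2 ^ W M ≤ 2 ^ K * Q M
  length-sums-Q zero    K = *-mono-≤ (m^n>0 2 K) ≤-refl
  length-sums-Q (suc M) K with L? M | w M ≤? K
  ... | no _  | _ = subst (λ e → length (sums M K) * 2 ^ e ≤ 2 ^ K * Q M) (sym (+-identityʳ (W M)))
                      (length-sums-Q M K)
  ... | yes _ | no _ = begin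
    l * 2 ^ (W M + v)          ≡⟨ cong (l *_) (^-distribˡ-+-* 2 (W M) v) ⟩
    l * (2 ^ W M * 2 ^ v)      ≡⟨ *-assoc l _ _ ⟨
    l * 2 ^ W M * 2 ^ v        ≤⟨ *-mono-≤ (length-sums-Q M K) (m≤m+n (2 ^ v) 1) ⟩
    2 ^ K * Q M * (2 ^ v + 1)  ≡⟨ *-assoc (2 ^ K) _ _ ⟩
    2 ^ K * (Q M * (2 ^ v + 1)) ∎
    where
    open ≤-Reasoning
    l = length (sums M K)
    v = w M
  ... | yes _ | yes v≤K = begin
    length (sums M K ++ map (M +_) (sums M (K ∸ v))) * 2 ^ (W M + v)
      ≡⟨ cong₂ _*_ (trans (length-++ (sums M K)) (cong (l +_) (length-map (M +_) (sums M (K ∸ v))))) (^-distribˡ-+-* 2 (W M) v) ⟩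
    (l + l′) * (2 ^ W M * 2 ^ v)                         ≡⟨ expand l l′ (2 ^ W M) (2 ^ v) ⟩
    l * 2 ^ W M * 2 ^ v + l′ * 2 ^ W M * 2 ^ v
      ≤⟨ +-mono-≤ (*-monoˡ-≤ (2 ^ v) (length-sums-Q M K)) (*-monoˡ-≤ (2 ^ v) (length-sums-Q M (K ∸ v))) ⟩
    2 ^ K * Q M * 2 ^ v + 2 ^ (K ∸ v) * Q M * 2 ^ v      ≡⟨ cong (2 ^ K * Q M * 2 ^ v +_) (swap (2 ^ (K ∸ v)) (Q M) (2 ^ v)) ⟩
    2 ^ K * Q M * 2 ^ v + 2 ^ (K ∸ v) * 2 ^ v * Q M      ≡⟨ cong (λ x → 2 ^ K * Q M * 2 ^ v + x * Q M) 2^K≡ ⟩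
    2 ^ K * Q M * 2 ^ v + 2 ^ K * Q M                    ≡⟨ collect (2 ^ K) (Q M) (2 ^ v) ⟩
    2 ^ K * (Q M * (2 ^ v + 1))                          ∎
    where
    open ≤-Reasoning
    v = w M
    l = length (sums M K)
    l′ = length (sums M (K ∸ v))
    2^K≡ : 2 ^ (K ∸ v) * 2 ^ v ≡ 2 ^ K
    2^K≡ = trans (sym (^-distribˡ-+-* 2 (K ∸ v) v)) (cong (2 ^_) (m∸n+n≡m v≤K))
    expand : ∀ a b c d → (a + b) * (c * d) ≡ a * c * d + b * c * d
    expand = solve-∀
    swap : ∀ a b c → a * b * c ≡ a * c * b
    swap = solve-∀
    collect : ∀ a b c → a * b * c + a * b ≡ a * (b * (c + 1))
    collect = solve-∀

  -- By `[2^w+1]^w≤` each factor 1 + 2^(-w) is at most 2^(1/w). Since w = 2^j divides `2 ^ D`,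
  -- raising to the power `2 ^ D` makes all these exponents integers.
  Q-bound : ∀ D M → (∀ a → a < M → j a ≤ D) →
    Q M ^ (2 ^ D) ≤ 2 ^ (W M * 2 ^ D + Σ< M (λ a → when (L? a) (2 ^ (D ∸ j a))))
  Q-bound D zero    j≤D = ≤-reflexive (^-zeroˡ (2 ^ D))
  Q-bound D (suc M) j≤D with ih ← Q-bound D M (λ a a<M → j≤D a (m<n⇒m<1+n a<M)) | L? M
  ... | no _  = subst (λ e → Q M ^ (2 ^ D) ≤ 2 ^ e)
                  (sym (cong₂ _+_ (cong (_* 2 ^ D) (+-identityʳ (W M))) (+-identityʳ C))) ih
    where
    C = Σ< M (λ a → when (L? a) (2 ^ (D ∸ j a)))
  ... | yes _ = begin
    (Q M * (2 ^ v + 1)) ^ N                    ≡⟨ [m*n]^k (Q M) (2 ^ v + 1) N ⟩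
    Q M ^ N * (2 ^ v + 1) ^ N                  ≤⟨ *-mono-≤ ih factor ⟩
    2 ^ (W M * N + C) * 2 ^ (v * N + c)        ≡⟨ ^-distribˡ-+-* 2 (W M * N + C) (v * N + c) ⟨
    2 ^ (W M * N + C + (v * N + c))            ≡⟨ cong (2 ^_) (regroup (W M) v N C c) ⟩
    2 ^ ((W M + v) * N + (C + c))              ∎
    where
    open ≤-Reasoning
    v = w M
    N = 2 ^ D
    C = Σ< M (λ a → when (L? a) (2 ^ (D ∸ j a)))
    c = 2 ^ (D ∸ j M)
    N≡ : v * c ≡ N
    N≡ = trans (sym (^-distribˡ-+-* 2 (j M) _)) (cong (2 ^_) (m+[n∸m]≡n (j≤D M ≤-refl)))
    regroup : ∀ W v N C c → W * N + C + (v * N + c) ≡ (W + v) * N + (C + c)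
    regroup = solve-∀
    factor : (2 ^ v + 1) ^ N ≤ 2 ^ (v * N + c)
    factor = begin
      (2 ^ v + 1) ^ N              ≡⟨ cong ((2 ^ v + 1) ^_) N≡ ⟨
      (2 ^ v + 1) ^ (v * c)        ≡⟨ ^-*-assoc (2 ^ v + 1) v c ⟨
      ((2 ^ v + 1) ^ v) ^ c        ≤⟨ ^-monoˡ-≤ c ([2^w+1]^w≤ (j M)) ⟩
      (2 * (2 ^ v) ^ v) ^ c        ≡⟨ [m*n]^k 2 ((2 ^ v) ^ v) c ⟩
      2 ^ c * ((2 ^ v) ^ v) ^ c    ≡⟨ cong (2 ^ c *_) (^-*-assoc (2 ^ v) v c) ⟩
      2 ^ c * (2 ^ v) ^ (v * c)    ≡⟨ cong (λ n → 2 ^ c * (2 ^ v) ^ n) N≡ ⟩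
      2 ^ c * (2 ^ v) ^ N          ≡⟨ cong (2 ^ c *_) (^-*-assoc 2 v N) ⟩
      2 ^ c * 2 ^ (v * N)          ≡⟨ ^-distribˡ-+-* 2 c (v * N) ⟨
      2 ^ (c + v * N)              ≡⟨ cong (2 ^_) (+-comm c (v * N)) ⟩
      2 ^ (v * N + c)              ∎

  -- `e` bounds the sum of the reciprocal weights. Taking the root of order `2 ^ D` in `Q-bound`
  -- gives `Q M ≤ 2 ^ (W M + e)`, and `2 ^ W M` cancels in `length-sums-Q`.
  length-sums : ∀ D e M K → (∀ a → a < M → j a ≤ D) →
    Σ< M (λ a → when (L? a) (2 ^ (D ∸ j a))) ≤ e * 2 ^ D → length (sums M K) ≤ 2 ^ (K + e)
  length-sums D e M K j≤D cheap = *-cancelʳ-≤ _ _ (2 ^ W M) {{m^n≢0 2 (W M)}} (begin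
    length (sums M K) * 2 ^ W M  ≤⟨ length-sums-Q M K ⟩
    2 ^ K * Q M                  ≤⟨ *-monoʳ-≤ (2 ^ K) Q≤ ⟩
    2 ^ K * 2 ^ (W M + e)        ≡⟨ cong (2 ^ K *_) (cong (2 ^_) (+-comm (W M) e)) ⟩
    2 ^ K * 2 ^ (e + W M)        ≡⟨ cong (2 ^ K *_) (^-distribˡ-+-* 2 e (W M)) ⟩
    2 ^ K * (2 ^ e * 2 ^ W M)    ≡⟨ *-assoc (2 ^ K) _ _ ⟨
    2 ^ K * 2 ^ e * 2 ^ W M      ≡⟨ cong (_* 2 ^ W M) (^-distribˡ-+-* 2 K e) ⟨
    2 ^ (K + e) * 2 ^ W M        ∎)
    where
    open ≤-Reasoning
    Q≤ : Q M ≤ 2 ^ (W M + e)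
    Q≤ = ^-cancelˡ-≤ (2 ^ D) {{m^n≢0 2 D}} (begin
      Q M ^ (2 ^ D)                ≤⟨ Q-bound D M j≤D ⟩
      2 ^ (W M * 2 ^ D + Σ< M (λ a → when (L? a) (2 ^ (D ∸ j a))))
                                   ≤⟨ ^-monoʳ-≤ 2 (+-monoʳ-≤ (W M * 2 ^ D) cheap) ⟩
      2 ^ (W M * 2 ^ D + e * 2 ^ D) ≡⟨ cong (2 ^_) (*-distribʳ-+ (2 ^ D) (W M) e) ⟨
      2 ^ ((W M + e) * 2 ^ D)      ≡⟨ ^-*-assoc 2 (W M + e) (2 ^ D) ⟨
      (2 ^ (W M + e)) ^ (2 ^ D)    ∎)

-- Averaging the weight of `A` over scales.

module _ {A : Pred ℕ 0ℓ} (A? : Decidable A) where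

  smallSize : ℕ → ℕ → ℕ
  smallSize s a = when (A? a ×-dec (a <? 2 ^ s)) a

  largeCost : ℕ → ℕ → ℕ → ℕ
  largeCost D s a = when (A? a ×-dec (2 ^ s ≤? a)) (cost D s a)

  -- For `s ≤ D`, this is `2 ^ D` times the total weight of `A` at the threshold `2 ^ s`: smaller
  -- elements count a / 2^s, the others 2^s / 2^(lg a).
  potential : ℕ → ℕ → ℕ
  potential D s = Σ< (suc (2 ^ D)) λ a → smallSize s a * 2 ^ (D ∸ s) + largeCost D s a

module _ {A : Pred ℕ 0ℓ} (A? : Decidable A) (pos : ∀ a → a ∈ A → 0 < a) where

  -- After exchanging the sums, each element of `A` contributes at most `2 * 2 ^ D` from the scales
  -- above it and as much from those below.
  Σ<-potential : ∀ D n → n ≤ suc D →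
    Σ< n (potential A? D) ≤ Σ< (suc (2 ^ D)) (λ a → when (A? a) 1) * (4 * 2 ^ D)
  Σ<-potential D n n≤1+D = begin
    Σ< n (potential A? D)                                         ≡⟨ Σ<-swap n M (λ s a → φ a s) ⟩
    Σ< M (λ a → Σ< n (φ a))                                    ≤⟨ Σ<-mono M bound ⟩
    Σ< M (λ a → when (A? a) 1 * (4 * 2 ^ D))                   ≡⟨ Σ<-*ʳ M _ _ ⟩
    Σ< M (λ a → when (A? a) 1) * (4 * 2 ^ D)                   ∎
    where
    open ≤-Reasoning
    M = suc (2 ^ D)
    φ : ℕ → ℕ → ℕ
    φ a s = smallSize A? s a * 2 ^ (D ∸ s) + largeCost A? D s a
    2+2 : ∀ x → 2 * x + 2 * x ≡ 1 * (4 * x)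
    2+2 = solve-∀
    bound : ∀ a → a < M → Σ< n (φ a) ≤ when (A? a) 1 * (4 * 2 ^ D)
    bound a (s≤s a≤) with A? a
    ... | no  _ = ≤-reflexive (Σ<-0 n)
    ... | yes p = begin
      Σ< n (λ s → when (a <? 2 ^ s) a * 2 ^ (D ∸ s) + when (2 ^ s ≤? a) (cost D s a))
        ≡⟨ Σ<-+ n _ _ ⟩
      Σ< n (λ s → when (a <? 2 ^ s) a * 2 ^ (D ∸ s)) + Σ< n (λ s → when (2 ^ s ≤? a) (cost D s a))
        ≡⟨ cong (_+ Σ< n (λ s → when (2 ^ s ≤? a) (cost D s a))) (Σ<-cong n λ s _ → when-*ʳ (a <? 2 ^ s) a _) ⟩
      Σ< n (λ s → when (a <? 2 ^ s) (a * 2 ^ (D ∸ s))) + Σ< n (λ s → when (2 ^ s ≤? a) (cost D s a))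
        ≤⟨ +-mono-≤ (Σ<-size D n a (pos a p) a≤ n≤1+D) (Σ<-cost D n a (pos a p) a≤) ⟩
      2 * 2 ^ D + 2 * 2 ^ D
        ≡⟨ 2+2 (2 ^ D) ⟩
      1 * (4 * 2 ^ D) ∎

  -- The potentials of the `2 * k` scales from `5 * k` on add up to at most h k² · 4 · 2^D, so one
  -- of them is at most the average h · 2k · 2^D. This bounds its small and its large part
  -- separately.
  goodScale : ∀ h k D → 0 < k → 7 * k ≤ D → Σ< (suc (2 ^ D)) (λ a → when (A? a) 1) ≤ h * (k * k) →
    ∃[ s ] 5 * k ≤ s × s ≤ 7 * k
      × Σ< (suc (2 ^ D)) (smallSize A? s) ≤ h * (2 * k * 2 ^ s)
      × Σ< (suc (2 ^ D)) (largeCost A? D s) ≤ h * (2 * k * 2 ^ D)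
  goodScale h k D 0<k 7k≤D sparse
    with Σ<-pigeonhole (2 * k) (λ i → potential A? D (5 * k + i)) (h * (2 * k * 2 ^ D)) average
    where
    open ≤-Reasoning
    regroup : ∀ h k x → h * (k * k) * (4 * x) ≡ 2 * k * (h * (2 * k * x))
    regroup = solve-∀
    average : Σ< (2 * k) (λ i → potential A? D (5 * k + i)) < 2 * k * suc (h * (2 * k * 2 ^ D))
    average = begin-strict
      Σ< (2 * k) (λ i → potential A? D (5 * k + i))  ≤⟨ Σ<-shift (5 * k) (2 * k) (potential A? D) ⟩
      Σ< (5 * k + 2 * k) (potential A? D)
        ≤⟨ Σ<-potential D (5 * k + 2 * k) (m≤n⇒m≤1+n (≤-trans (≤-reflexive (sym (*-distribʳ-+ k 5 2))) 7k≤D)) ⟩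
      Σ< (suc (2 ^ D)) (λ a → when (A? a) 1) * (4 * 2 ^ D)  ≤⟨ *-monoˡ-≤ (4 * 2 ^ D) sparse ⟩
      h * (k * k) * (4 * 2 ^ D)                      ≡⟨ regroup h k (2 ^ D) ⟩
      2 * k * (h * (2 * k * 2 ^ D))
        <⟨ *-monoʳ-< (2 * k) {{>-nonZero (*-mono-≤ {1} {2} (s≤s z≤n) 0<k)}} (n<1+n _) ⟩
      2 * k * suc (h * (2 * k * 2 ^ D))              ∎
  ... | i , i<2k , low = s , m≤m+n (5 * k) i , s≤7k , small , large
    where
    open ≤-Reasoning
    s M small-total large-total : ℕ
    s = 5 * k + i
    M = suc (2 ^ D)
    small-total = Σ< M (smallSize A? s)
    large-total = Σ< M (largeCost A? D s)
    s≤7k : s ≤ 7 * k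
    s≤7k = ≤-trans (+-monoʳ-≤ (5 * k) (<⇒≤ i<2k)) (≤-reflexive (sym (*-distribʳ-+ k 5 2)))
    parts : small-total * 2 ^ (D ∸ s) + large-total ≤ h * (2 * k * 2 ^ D)
    parts = begin
      small-total * 2 ^ (D ∸ s) + large-total
        ≡⟨ cong (_+ large-total) (Σ<-*ʳ M (smallSize A? s) (2 ^ (D ∸ s))) ⟨
      Σ< M (λ a → smallSize A? s a * 2 ^ (D ∸ s)) + large-total
        ≡⟨ Σ<-+ M (λ a → smallSize A? s a * 2 ^ (D ∸ s)) (largeCost A? D s) ⟨
      potential A? D s         ≤⟨ low ⟩
      h * (2 * k * 2 ^ D)      ∎
    large : large-total ≤ h * (2 * k * 2 ^ D)
    large = ≤-trans (m≤n+m large-total (small-total * 2 ^ (D ∸ s))) parts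
    reassoc : ∀ a b c d → a * (b * (c * d)) ≡ a * (b * c) * d
    reassoc = solve-∀
    small : small-total ≤ h * (2 * k * 2 ^ s)
    small = *-cancelʳ-≤ _ _ (2 ^ (D ∸ s)) {{m^n≢0 2 (D ∸ s)}} (begin
      small-total * 2 ^ (D ∸ s)             ≤⟨ m≤m+n _ _ ⟩
      small-total * 2 ^ (D ∸ s) + large-total ≤⟨ parts ⟩
      h * (2 * k * 2 ^ D)                   ≡⟨ cong (λ e → h * (2 * k * 2 ^ e)) (m+[n∸m]≡n (≤-trans s≤7k 7k≤D)) ⟨
      h * (2 * k * 2 ^ (s + (D ∸ s)))       ≡⟨ cong (λ x → h * (2 * k * x)) (^-distribˡ-+-* 2 s (D ∸ s)) ⟩
      h * (2 * k * (2 ^ s * 2 ^ (D ∸ s)))   ≡⟨ reassoc h (2 * k) (2 ^ s) (2 ^ (D ∸ s)) ⟩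
      h * (2 * k * 2 ^ s) * 2 ^ (D ∸ s)     ∎)

-- One stage: the new colouring and the targets it may represent.

colour : ℕ → ℕ → ℕ → (c f g : ℕ → ℕ) → ℕ → ℕ
colour h X u c f g a with a ≤? X | a <? u
... | yes _ | _     = c a
... | no  _ | yes _ = f a
... | no  _ | no  _ = h + g a

module _ (h X u : ℕ) (c f g : ℕ → ℕ) where

  colour-old : ∀ {a} → a ≤ X → colour h X u c f g a ≡ c a
  colour-old {a} a≤X with a ≤? X | a <? u
  ... | yes _ | _  = refl
  ... | no ≰  | _  = contradiction a≤X ≰

  colour-small : ∀ {a} → X < a → a < u → colour h X u c f g a ≡ f a
  colour-small {a} X<a a<u with a ≤? X | a <? u
  ... | yes a≤X | _     = contradiction a≤X (<⇒≱ X<a)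
  ... | no _    | yes _ = refl
  ... | no _    | no ≮  = contradiction a<u ≮

  colour-large : ∀ {a} → X < a → u ≤ a → colour h X u c f g a ≡ h + g a
  colour-large {a} X<a u≤a with a ≤? X | a <? u
  ... | yes a≤X | _       = contradiction a≤X (<⇒≱ X<a)
  ... | no _    | yes a<u = contradiction u≤a (<⇒≱ a<u)
  ... | no _    | no _    = refl

  colour-< : (∀ a → c a < 2 * h) → (∀ a → f a < h) → (∀ a → g a < h) → ∀ a → colour h X u c f g a < 2 * h
  colour-< c< f< g< a with a ≤? X | a <? u
  ... | yes _ | _     = c< a
  ... | no _  | yes _ = <-≤-trans (f< a) (m≤m+n h _)
  ... | no _  | no _  = +-monoʳ-< h (<-≤-trans (g< a) (m≤m+n h 0))

Avoids : ℕ → Pred ℕ 0ℓ → (ℕ → ℕ) → ℕ → Set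
Avoids r A c n = ∀ i → i < r → ∀ xs → Unique xs → All (λ a → A a × c a ≡ i) xs → sum xs ≢ n

-- At most `suc X` numbers survive, each at most `X`. The bound does not involve `M`, so old
-- elements shift any sum by an amount fixed before the stage begins.
Σ<-initial : ∀ M X → Σ< M (λ a → when (a ≤? X) a) ≤ suc X * X
Σ<-initial M X = begin
  Σ< M (λ a → when (a ≤? X) a)        ≤⟨ Σ<-support M (suc X) _ (λ a X<a → when-no (a ≤? X) (<⇒≱ X<a)) ⟩
  Σ< (suc X) (λ a → when (a ≤? X) a)  ≤⟨ Σ<-mono (suc X) (λ { a (s≤s a≤X) → ≤-trans (when-≤ (a ≤? X)) a≤X }) ⟩
  Σ< (suc X) (λ _ → X)                ≡⟨ Σ<-const (suc X) X ⟩
  suc X * X                           ∎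
  where open ≤-Reasoning

module Stage
  {A : Pred ℕ 0ℓ} (A? : Decidable A) (pos : ∀ a → a ∈ A → 0 < a)
  (r h X s M K : ℕ) (c f g : ℕ → ℕ)
  where

  open ≤-Reasoning

  u Z : ℕ
  u = 2 ^ s
  Z = suc X * X

  c′ : ℕ → ℕ
  c′ = colour h X u c f g

  -- Colour `i ≥ h` corresponds to bin `i ∸ h` of `g`. For `i < h` truncation defaults to bin 0,
  -- which merely enlarges `bad`.
  L : ℕ → ℕ → Set
  L i a = g a ≡ i ∸ h × A a × u ≤ a

  L? : ∀ i a → Dec (L i a)
  L? i a = (g a ≟ i ∸ h) ×-dec (A? a ×-dec (u ≤? a))

  -- For `a ≥ u` the weight is the largest power of two not exceeding a / u, and `cost D s a` is its
  -- reciprocal scaled by `2 ^ D`.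
  module SS i = SubsetSums (L? i) (λ a → lg a ∸ s)

  near : ℕ → List ℕ
  near y = applyUpTo (y +_) (suc Z)

  -- Candidates for values of the form y + z, with y a sum of large elements of one bin and z,
  -- between 0 and `Z`, coming from the old elements.
  bad : List ℕ
  bad = concatMap (λ i → concatMap near (SS.sums i M K)) (upTo r)

  length-bad : ∀ D e → M ≤ suc (2 ^ D) →
    (∀ i → Σ< M (λ a → when (g a ≟ i) (largeCost A? D s a)) ≤ e * 2 ^ D) →
    length bad ≤ r * (2 ^ (K + e) * suc Z)
  length-bad D e M≤ loads = begin
    length bad
      ≤⟨ length-concatMap-≤ _ (upTo r) (2 ^ (K + e) * suc Z) (λ i → begin
           length (concatMap near (SS.sums i M K))
             ≤⟨ length-concatMap-≤ near (SS.sums i M K) (suc Z) (λ y → ≤-reflexive (length-applyUpTo (y +_) (suc Z))) ⟩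
           length (SS.sums i M K) * suc Z  ≤⟨ *-monoˡ-≤ (suc Z) (length-sums-L i) ⟩
           2 ^ (K + e) * suc Z             ∎) ⟩
    length (upTo r) * (2 ^ (K + e) * suc Z)  ≡⟨ cong (_* (2 ^ (K + e) * suc Z)) (length-upTo r) ⟩
    r * (2 ^ (K + e) * suc Z)                ∎
    where
    length-sums-L : ∀ i → length (SS.sums i M K) ≤ 2 ^ (K + e)
    length-sums-L i = SS.length-sums i D e M K
      (λ a a<M → ≤-trans (m∸n≤m (lg a) s) (lg-≤ a (s≤s⁻¹ (≤-trans a<M M≤))))
      (begin
        Σ< M (λ a → when (L? i a) (cost D s a))
          ≡⟨ Σ<-cong M (λ a _ → when-× (g a ≟ i ∸ h) (A? a ×-dec (u ≤? a)) _) ⟩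
        Σ< M (λ a → when (g a ≟ i ∸ h) (largeCost A? D s a))
          ≤⟨ loads (i ∸ h) ⟩
        e * 2 ^ D ∎)

  -- A colour below `h` contains, within range, only old elements and one bin of small ones, of
  -- total less than `K * u`. In a colour from `h` on, every new element is large, so a
  -- representation of `n` would put `n` into `bad`.
  avoids : (∀ a → f a < h) →
    (∀ i → Z + Σ< M (λ a → when (f a ≟ i) (smallSize A? s a)) < K * u) →
    ∀ n → n < M → K * u ≤ n → n < K * u + u → n ∉ₗ bad → Avoids r A c′ n
  avoids f<h light n n<M Ku≤n n<Ku+u n∉bad i i<r xs unique class sum≡n = by-type (i <? h)
    where
      below : All (_< M) xs
      below = All.map (λ le → ≤-<-trans le (subst (_< M) (sym sum≡n) n<M)) (sum-∈-≤ xs)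

      n≡ : n ≡ Σ< M (λ a → when (a ∈? xs) a)
      n≡ = trans (sym sum≡n) (sum-as-Σ< M xs unique below)

      by-type : Dec (i < h) → _
      by-type (yes i<h) = <-irrefl refl (begin-strict
        n                                           ≡⟨ n≡ ⟩
        Σ< M (λ a → when (a ∈? xs) a)               ≤⟨ Σ<-mono M (λ a _ → term a) ⟩
        Σ< M (λ a → when (a ≤? X) a + when (f a ≟ i) (smallSize A? s a))
                                                    ≡⟨ Σ<-+ M _ _ ⟩
        Σ< M (λ a → when (a ≤? X) a) + Σ< M (λ a → when (f a ≟ i) (smallSize A? s a))
                                                    ≤⟨ +-monoˡ-≤ _ (Σ<-initial M X) ⟩
        Z + Σ< M (λ a → when (f a ≟ i) (smallSize A? s a))
                                                    <⟨ light i ⟩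
        K * u                                       ≤⟨ Ku≤n ⟩
        n                                           ∎)
        where
        term : ∀ a → when (a ∈? xs) a ≤ when (a ≤? X) a + when (f a ≟ i) (smallSize A? s a)
        term a = by-cases (a ∈? xs) (a ≤? X) (a <? u)
          where
          by-cases : Dec (a ∈ₗ xs) → Dec (a ≤ X) → Dec (a < u) → _
          by-cases (no a∉) _ _ = ≤-trans (≤-reflexive (when-no (a ∈? xs) a∉)) z≤n
          by-cases (yes _) (yes a≤X) _ = ≤-trans (when-≤ (a ∈? xs))
            (≤-trans (≤-reflexive (sym (when-yes (a ≤? X) a≤X))) (m≤m+n _ _))
          by-cases (yes a∈) (no a≰X) (yes a<u) = ≤-trans (when-≤ (a ∈? xs)) (≤-trans (≤-reflexive (sym
            (trans (when-yes (f a ≟ i) (trans (sym (colour-small h X u c f g (≰⇒> a≰X) a<u)) (proj₂ (All.lookup class a∈))))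
              (when-yes (A? a ×-dec (a <? u)) (proj₁ (All.lookup class a∈) , a<u))))) (m≤n+m _ _))
          by-cases (yes a∈) (no a≰X) (no a≮u) = contradiction i<h (≤⇒≯ (≤-trans (m≤m+n h (g a)) (≤-reflexive
            (trans (sym (colour-large h X u c f g (≰⇒> a≰X) (≮⇒≥ a≮u))) (proj₂ (All.lookup class a∈))))))
      by-type (no i≮h) = n∉bad n∈bad
        where
        R? : ∀ a → Dec (a ∈ₗ xs × X < a)
        R? a = (a ∈? xs) ×-dec (X <? a)

        R⊆L : ∀ a → a ∈ₗ xs × X < a → L i a
        R⊆L a (a∈ , X<a) with u ≤? a
        ... | yes u≤a = sym (trans (cong (_∸ h) (trans (sym (proj₂ (All.lookup class a∈))) (colour-large h X u c f g X<a u≤a)))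
                              (m+n∸m≡n h (g a)))
                        , proj₁ (All.lookup class a∈) , u≤a
        -- A new element below `u` has colour `f a < h`, which contradicts `i ≥ h`.
        ... | no  u≰a = contradiction (subst (_< h) (trans (sym (colour-small h X u c f g X<a (≰⇒> u≰a)))
                                        (proj₂ (All.lookup class a∈))) (f<h a)) i≮h

        z y : ℕ
        z = Σ< M (λ a → when ((a ∈? xs) ×-dec (a ≤? X)) a)
        y = Σ< M (λ a → when (R? a) a)

        n≡y+z : n ≡ y + z
        n≡y+z = trans n≡ (trans (Σ<-cong M λ a _ → split a) (Σ<-+ M _ _))
          where
          split : ∀ a → when (a ∈? xs) a ≡ when (R? a) a + when ((a ∈? xs) ×-dec (a ≤? X)) a
          split a = by-cases (a ∈? xs) (a ≤? X)
            where
            by-cases : Dec (a ∈ₗ xs) → Dec (a ≤ X) → _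
            by-cases (no a∉) _ = trans (when-no (a ∈? xs) a∉)
              (sym (cong₂ _+_ (when-no (R? a) (a∉ ∘ proj₁)) (when-no ((a ∈? xs) ×-dec (a ≤? X)) (a∉ ∘ proj₁))))
            by-cases (yes a∈) (yes a≤X) = trans (when-yes (a ∈? xs) a∈)
              (sym (cong₂ _+_ (when-no (R? a) (≤⇒≯ a≤X ∘ proj₂)) (when-yes ((a ∈? xs) ×-dec (a ≤? X)) (a∈ , a≤X))))
            by-cases (yes a∈) (no a≰X) = trans (when-yes (a ∈? xs) a∈)
              (trans (sym (+-identityʳ a)) (sym (cong₂ _+_ (when-yes (R? a) (a∈ , ≰⇒> a≰X)) (when-no ((a ∈? xs) ×-dec (a ≤? X)) (a≰X ∘ proj₂)))))

        z≤Z : z ≤ Z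
        z≤Z = ≤-trans (Σ<-mono M λ a _ → ≤-trans (≤-reflexive (when-× (a ∈? xs) (a ≤? X) a)) (when-≤ (a ∈? xs))) (Σ<-initial M X)

        -- Each weight times `u` is at most its element, so the total weight times `u` is below
        -- `suc K * u`; integrality gives the bound `K`.
        weight≤K : Σ< M (λ a → when (R? a) (SS.w i a)) ≤ K
        weight≤K = s≤s⁻¹ (*-cancelʳ-< u _ (suc K) (begin-strict
          Σ< M (λ a → when (R? a) (SS.w i a)) * u     ≡⟨ Σ<-*ʳ M _ u ⟨
          Σ< M (λ a → when (R? a) (SS.w i a) * u)     ≤⟨ Σ<-mono M (λ a _ → term a) ⟩
          y                                           ≤⟨ m≤m+n y z ⟩
          y + z                                       ≡⟨ n≡y+z ⟨
          n                                           <⟨ n<Ku+u ⟩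
          K * u + u                                   ≡⟨ +-comm (K * u) u ⟩
          suc K * u                                   ∎))
          where
          term : ∀ a → when (R? a) (SS.w i a) * u ≤ when (R? a) a
          term a = ≤-trans (≤-reflexive (when-*ʳ (R? a) (SS.w i a) u)) (when-mono-≤ (R? a) λ p →
            let _ , a∈A , u≤a = R⊆L a p in begin
            2 ^ (lg a ∸ s) * 2 ^ s   ≡⟨ ^-distribˡ-+-* 2 (lg a ∸ s) s ⟨
            2 ^ (lg a ∸ s + s)       ≡⟨ cong (2 ^_) (m∸n+n≡m (≤lg s a u≤a)) ⟩
            2 ^ lg a                 ≤⟨ 2^lg≤ a (pos a a∈A) ⟩
            a                        ∎)

        n∈bad : n ∈ₗ bad
        n∈bad = ∈-concatMap _ (∈-upTo⁺ i<r)
          (∈-concatMap near (SS.∈-sums i R? R⊆L M K weight≤K)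
            (subst (_∈ₗ near y) (sym n≡y+z) (∈-applyUpTo⁺ (y +_) (s≤s z≤Z))))

-- Extending a colouring so that it misses a new target.

-- The target `n` becomes the next `X`. A sum equal to `n` uses only elements up to `n`, whose
-- colours later stages preserve, so `n` stays avoided.
Extension : ℕ → ℕ → Pred ℕ 0ℓ → (ℕ → ℕ) → ℕ → Set
Extension r h A c X =
  ∃[ c′ ] ∃[ n ] X < n × (∀ a → a ≤ X → c′ a ≡ c a) × (∀ a → c′ a < 2 * h) × Avoids r A c′ n

module _ {A : Pred ℕ 0ℓ} (A? : Decidable A) (pos : ∀ a → a ∈ A → 0 < a) (r h : ℕ) (0<h : 0 < h) where

  -- M is a variable, not suc (2 ^ D), so that Σ< M and sums M do not unfold during type checking.
  extend : ∀ c X k D M → (∀ a → c a < 2 * h) → 0 < k → k + 7 * k ≤ D → M ≡ suc (2 ^ D) →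
    Σ< (suc (2 ^ D)) (λ a → when (A? a) 1) ≤ h * (k * k) →
    2 * k + 3 ≤ 2 ^ k → suc X * X < 2 ^ (5 * k) →
    r * (2 ^ (4 * k + 3) * suc (suc X * X)) < 2 ^ (5 * k) → Extension r h A c X
  extend c X k D M c< 0<k 8k≤D M≡ sparse 2k+3≤2^k Z<2^5k room =
    let s , 5k≤s , s≤7k , small , large = goodScale A? pos h k D 0<k (≤-trans (m≤n+m (7 * k) k) 8k≤D) sparse
    in at-scale s 5k≤s s≤7k (subst (λ M → Σ< M (smallSize A? s) ≤ h * (2 * k * 2 ^ s)) (sym M≡) small)
         (subst (λ M → Σ< M (largeCost A? D s) ≤ h * (2 * k * 2 ^ D)) (sym M≡) large)
    where
    open ≤-Reasoning

    Z : ℕ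
    Z = suc X * X

    module _ (s : ℕ) (5k≤s : 5 * k ≤ s) (s≤7k : s ≤ 7 * k) where

      u : ℕ
      u = 2 ^ s

      Z<u : Z < u
      Z<u = <-≤-trans Z<2^5k (^-monoʳ-≤ 2 5k≤s)

      module _ (f g : ℕ → ℕ) (f<h : ∀ a → f a < h) (g<h : ∀ a → g a < h)
        (f-loads : ∀ i → Σ< M (λ a → when (f a ≟ i) (smallSize A? s a)) ≤ 2 * k * u + u)
        (g-loads : ∀ i → Σ< M (λ a → when (g a ≟ i) (largeCost A? D s a)) ≤ 2 * k * 2 ^ D + 2 ^ D)
        where

        -- The budget `2 * k + 2` covers a bin of small elements, at most 2k + 1 units of `u`,
        -- together with the old elements, less than one unit.
        open Stage A? pos r h X s M (2 * k + 2) c f g using (bad; length-bad; avoids)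

        short : length bad < u
        short = begin-strict
          length bad
            -- A bin of large elements has cost at most 2k + 1 units of `2 ^ D`. The resulting
            -- exponent 4k + 3 leaves a factor 2^k / 8 of `2 ^ (5 * k)` to absorb r (Z + 1).
            ≤⟨ length-bad D (2 * k + 1) (≤-reflexive M≡)
                 (λ i → ≤-trans (g-loads i) (≤-reflexive (collect (2 * k) (2 ^ D)))) ⟩
          r * (2 ^ (2 * k + 2 + (2 * k + 1)) * suc Z)  ≡⟨ cong (λ e → r * (2 ^ e * suc Z)) (exponent k) ⟩
          r * (2 ^ (4 * k + 3) * suc Z)                <⟨ room ⟩
          2 ^ (5 * k)                                  ≤⟨ ^-monoʳ-≤ 2 5k≤s ⟩
          u                                            ∎
          where
          exponent : ∀ k → 2 * k + 2 + (2 * k + 1) ≡ 4 * k + 3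
          exponent = solve-∀
          collect : ∀ a b → a * b + b ≡ (a + 1) * b
          collect = solve-∀

        light : ∀ i → Z + Σ< M (λ a → when (f a ≟ i) (smallSize A? s a)) < (2 * k + 2) * u
        light i = begin-strict
          Z + Σ< M (λ a → when (f a ≟ i) (smallSize A? s a))  ≤⟨ +-monoʳ-≤ Z (f-loads i) ⟩
          Z + (2 * k * u + u)                                 <⟨ +-monoˡ-< (2 * k * u + u) Z<u ⟩
          u + (2 * k * u + u)                                 ≡⟨ collect (2 * k) u ⟩
          (2 * k + 2) * u                                     ∎
          where
          collect : ∀ a b → b + (a * b + b) ≡ (a + 2) * b
          collect = solve-∀

        at-target : ∀ n → (2 * k + 2) * u ≤ n → n < (2 * k + 2) * u + u → n ∉ₗ bad → Extension r h A c X
        at-target n Ku≤n n<Ku+u n∉bad =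
          colour h X u c f g , n , X<n
          , (λ a → colour-old h X u c f g) , colour-< h X u c f g c< f<h g<h
          , avoids f<h light n n<M Ku≤n n<Ku+u n∉bad
          where
          X<n : X < n
          X<n = begin-strict
            X                  ≤⟨ m≤n*m X (suc X) ⟩
            Z                  <⟨ Z<u ⟩
            u                  ≤⟨ m≤n*m u (2 * k + 2) {{>-nonZero (≤-trans (s≤s z≤n) (m≤n+m 2 (2 * k)))}} ⟩
            (2 * k + 2) * u    ≤⟨ Ku≤n ⟩
            n                  ∎
          collect : ∀ a b → (a + 2) * b + b ≡ (a + 3) * b
          collect = solve-∀
          -- The extra `k` in `k + 7 * k ≤ D` absorbs the factor 2k + 3, so the target stays in the
          -- range where the density of `A` is controlled.
          n<M : n < M
          n<M = subst (n <_) (sym M≡) (m<n⇒m<1+n (begin-strict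
            n                        <⟨ n<Ku+u ⟩
            (2 * k + 2) * u + u      ≡⟨ collect (2 * k) u ⟩
            (2 * k + 3) * u          ≤⟨ *-mono-≤ 2k+3≤2^k (^-monoʳ-≤ 2 s≤7k) ⟩
            2 ^ k * 2 ^ (7 * k)      ≡⟨ ^-distribˡ-+-* 2 k (7 * k) ⟨
            2 ^ (k + 7 * k)          ≤⟨ ^-monoʳ-≤ 2 8k≤D ⟩
            2 ^ D                    ∎))

        at-colours : Extension r h A c X
        at-colours = let n , Ku≤n , n<Ku+u , n∉bad = ∃-∉ ((2 * k + 2) * u) u bad short
                     in at-target n Ku≤n n<Ku+u n∉bad

      at-scale : Σ< M (smallSize A? s) ≤ h * (2 * k * u) → Σ< M (largeCost A? D s) ≤ h * (2 * k * 2 ^ D) →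
        Extension r h A c X
      at-scale small large =
        -- A single small element is below `u` and a single cost is at most `2 ^ D`, so greedy
        -- packing exceeds the average by at most one unit.
        let f , f<h , f-loads = balance h (2 * k * u) u M (smallSize A? s) 0<h
              (λ a _ → ≤-trans (when-mono-≤ (A? a ×-dec (a <? u)) (<⇒≤ ∘ proj₂)) (when-≤ (A? a ×-dec (a <? u)))) small
            g , g<h , g-loads = balance h (2 * k * 2 ^ D) (2 ^ D) M (largeCost A? D s) 0<h
              (λ a _ → ≤-trans (when-≤ (A? a ×-dec (u ≤? a))) (^-monoʳ-≤ 2 (m∸n≤m D (lg a ∸ s)))) large
        in at-colours f g f<h g<h f-loads g-loads

-- Choice of parameters from the density hypothesis.

2k+3≤2^k : ∀ {k} → 4 ≤ k → 2 * k + 3 ≤ 2 ^ k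
2k+3≤2^k {k} 4≤k = subst (λ k → 2 * k + 3 ≤ 2 ^ k) (m∸n+n≡m 4≤k) (shifted (k ∸ 4))
  where
  open ≤-Reasoning
  regroup : ∀ m → 2 * (m + 4) + 3 + (5 + 14 * m) ≡ (1 + m) * 16
  regroup = solve-∀
  shifted : ∀ m → 2 * (m + 4) + 3 ≤ 2 ^ (m + 4)
  shifted m = begin
    2 * (m + 4) + 3                 ≤⟨ m≤m+n _ (5 + 14 * m) ⟩
    2 * (m + 4) + 3 + (5 + 14 * m)  ≡⟨ regroup m ⟩
    suc m * 16                      ≤⟨ *-monoˡ-≤ 16 (n<2^n m) ⟩
    2 ^ m * 2 ^ 4                   ≡⟨ ^-distribˡ-+-* 2 m 4 ⟨
    2 ^ (m + 4)                     ∎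

-- Two families of `h` colours have to fit into `r`, while `r ≤ 1 + 2 * h` converts the factor r - 1
-- of the hypothesis into 2h.
halve : ∀ r → ∃[ h ] 2 * h ≤ r × r ≤ 1 + 2 * h
halve zero          = 0 , z≤n , z≤n
halve (suc zero)    = 0 , z≤n , s≤s z≤n
halve (suc (suc r)) =
  let h , lo , hi = halve r
  in suc h , subst (_≤ 2 + r) (sym (*-suc 2 h)) (+-monoʳ-≤ 2 lo)
           , subst (λ x → 2 + r ≤ 1 + x) (sym (*-suc 2 h)) (+-monoʳ-≤ 2 hi)

module Density
  {A : Pred ℕ 0ℓ} (A? : Decidable A) (pos : ∀ a → a ∈ A → 0 < a)
  (r h : ℕ) (0<h : 0 < h) (2h≤r : 2 * h ≤ r) (r≤1+2h : r ≤ 1 + 2 * h)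
  (N : ℕ) (sparse : ∀ n → N ≤ n → count A? n ≤ (r ∸ 1) / 140 ·[log₂ n ]²)
  where

  open ≤-Reasoning

  0<r : 0 < r
  0<r = ≤-trans 0<h (≤-trans (m≤m+n h _) 2h≤r)

  k≤8k : ∀ k → k ≤ 8 * k
  k≤8k k = m≤n*m k 8

  -- At n = 2^(8k) the hypothesis gives 140 · A(n) ≤ (r - 1)(8k)² ≤ 128 h k², which is at most 140 h
  -- k².
  sparse-2^8k : ∀ k → N ≤ k → Σ< (suc (2 ^ (8 * k))) (λ a → when (A? a) 1) ≤ h * (k * k)
  sparse-2^8k k N≤k = *-cancelʳ-≤ _ _ 140 (begin
    Σ< (suc (2 ^ (8 * k))) (λ a → when (A? a) 1) * 140  ≡⟨ cong (_* 140) (count-as-Σ< A? (λ a → <-irrefl refl (pos 0 a)) (2 ^ (8 * k))) ⟩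
    count A? (2 ^ (8 * k)) * 140                        ≡⟨ *-identityʳ _ ⟨
    count A? (2 ^ (8 * k)) * 140 * 1 ^ 2
      -- The rational 8k / 1 is the exact logarithm, so the upper cut is used at its minimum.
      ≤⟨ sparse (2 ^ (8 * k)) N≤2^8k (8 * k) 1 (s≤s z≤n) (≤-reflexive (*-identityʳ _)) ⟩
    (r ∸ 1) * (8 * k) ^ 2                               ≤⟨ *-monoˡ-≤ ((8 * k) ^ 2) (∸-monoˡ-≤ 1 r≤1+2h) ⟩
    2 * h * (8 * k) ^ 2                                 ≤⟨ m≤m+n _ (12 * (h * (k * k))) ⟩
    2 * h * (8 * k) ^ 2 + 12 * (h * (k * k))            ≡⟨ regroup h k ⟩
    h * (k * k) * 140                                   ∎)
    where
    N≤2^8k : N ≤ 2 ^ (8 * k)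
    N≤2^8k = ≤-trans N≤k (≤-trans (k≤8k k) (<⇒≤ (n<2^n (8 * k))))
    regroup : ∀ h k → 2 * h * (8 * k * (8 * k * 1)) + 12 * (h * (k * k)) ≡ h * (k * k) * 140
    regroup = solve-∀

  -- Lower bounds linear in r (Z + 1) suffice, since `k < 2 ^ k` supplies the exponential gap
  -- between 4k + 3 and 5k.
  extend-at : ∀ c X k → (∀ a → c a < 2 * h) → 4 ≤ k → N ≤ k → r * (8 * suc (suc X * X)) ≤ k →
    Extension r h A c X
  extend-at c X k c< 4≤k N≤k r8Z≤k = extend A? pos r h 0<h c X k (8 * k) (suc (2 ^ (8 * k))) c< (≤-trans (s≤s z≤n) 4≤k) ≤-refl refl
    (sparse-2^8k k N≤k) (2k+3≤2^k 4≤k) Z<2^5k room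
    where
    Z = suc X * X
    Z<2^5k : Z < 2 ^ (5 * k)
    Z<2^5k = begin-strict
      Z                ≤⟨ n≤1+n Z ⟩
      suc Z            ≤⟨ m≤n*m (suc Z) 8 ⟩
      8 * suc Z        ≤⟨ m≤n*m (8 * suc Z) r {{>-nonZero 0<r}} ⟩
      r * (8 * suc Z)  ≤⟨ r8Z≤k ⟩
      k                ≤⟨ m≤n*m k 5 ⟩
      5 * k            <⟨ n<2^n (5 * k) ⟩
      2 ^ (5 * k)      ∎
    regroup : ∀ r p z → r * (p * 8 * z) ≡ r * (8 * z) * p
    regroup = solve-∀
    room : r * (2 ^ (4 * k + 3) * suc Z) < 2 ^ (5 * k)
    room = begin-strict
      r * (2 ^ (4 * k + 3) * suc Z)     ≡⟨ cong (λ x → r * (x * suc Z)) (^-distribˡ-+-* 2 (4 * k) 3) ⟩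
      r * (2 ^ (4 * k) * 8 * suc Z)     ≡⟨ regroup r (2 ^ (4 * k)) (suc Z) ⟩
      r * (8 * suc Z) * 2 ^ (4 * k)     ≤⟨ *-monoˡ-≤ (2 ^ (4 * k)) r8Z≤k ⟩
      k * 2 ^ (4 * k)                   <⟨ *-monoˡ-< (2 ^ (4 * k)) {{m^n≢0 2 (4 * k)}} (n<2^n k) ⟩
      2 ^ k * 2 ^ (4 * k)               ≡⟨ ^-distribˡ-+-* 2 k (4 * k) ⟨
      2 ^ (5 * k)                       ∎

  next : ∀ c X → (∀ a → c a < 2 * h) → Extension r h A c X
  -- The sum of the three lower bounds imposed on `k` dominates each of them.
  next c X c< = extend-at c X (4 + (N + r * (8 * suc (suc X * X)))) c<
    (m≤m+n 4 _) (≤-trans (m≤m+n N _) (m≤n+m _ 4)) (≤-trans (m≤n+m _ N) (m≤n+m _ 4))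

-- The limit colouring and its infinitely many missed targets.

module Limit
  {A : Pred ℕ 0ℓ} (A? : Decidable A) (pos : ∀ a → a ∈ A → 0 < a)
  (r h : ℕ) (0<h : 0 < h) (2h≤r : 2 * h ≤ r)
  (next : ∀ c X → (∀ a → c a < 2 * h) → Extension r h A c X)
  where

  State : Set
  State = Σ[ c ∈ (ℕ → ℕ) ] ℕ × (∀ a → c a < 2 * h)

  colouring : State → ℕ → ℕ
  colouring (c , _ , _) = c

  horizon : State → ℕ
  horizon (_ , X , _) = X

  step : State → State
  step (c , X , c<) = let c′ , n , _ , _ , c′< , _ = next c X c< in c′ , n , c′<

  horizon-step : ∀ σ → horizon σ < horizon (step σ)
  horizon-step (c , X , c<) = let _ , _ , X<n , _ = next c X c< in X<n

  colouring-step : ∀ σ {a} → a ≤ horizon σ → colouring (step σ) a ≡ colouring σ a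
  colouring-step (c , X , c<) {a} = let _ , _ , _ , agree , _ = next c X c< in agree a

  avoids-step : ∀ σ → Avoids r A (colouring (step σ)) (horizon (step σ))
  avoids-step (c , X , c<) = let _ , _ , _ , _ , _ , av = next c X c< in av

  state : ℕ → State
  state zero    = (λ _ → 0) , 0 , λ _ → *-mono-≤ {1} {2} (s≤s z≤n) 0<h
  state (suc m) = step (state m)

  m≤horizon : ∀ m → m ≤ horizon (state m)
  m≤horizon zero    = z≤n
  m≤horizon (suc m) = ≤-<-trans (m≤horizon m) (horizon-step (state m))

  stable : ∀ d m {a} → a ≤ horizon (state m) →
    a ≤ horizon (state (d + m)) × colouring (state (d + m)) a ≡ colouring (state m) a
  stable zero    m a≤ = a≤ , refl
  stable (suc d) m a≤ =
    let a≤′ , eq = stable d m a≤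
    in ≤-trans a≤′ (<⇒≤ (horizon-step (state (d + m)))) , trans (colouring-step (state (d + m)) a≤′) eq

  stable-≤ : ∀ {m m′ a} → m ≤ m′ → a ≤ horizon (state m) → colouring (state m′) a ≡ colouring (state m) a
  stable-≤ {m} {m′} {a} m≤m′ a≤ =
    subst (λ x → colouring (state x) a ≡ colouring (state m) a) (m∸n+n≡m m≤m′) (proj₂ (stable (m′ ∸ m) m a≤))

  -- A diagonal choice: horizons grow strictly, so `a` lies within the horizon of stage `a` and its
  -- colour is final there.
  limit : ℕ → ℕ
  limit a = colouring (state a) a

  limit-agrees : ∀ m {a} → a ≤ horizon (state m) → limit a ≡ colouring (state m) a
  limit-agrees m {a} a≤ with ≤-total a m
  ... | inj₁ a≤m = sym (stable-≤ a≤m (m≤horizon a))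
  ... | inj₂ m≤a = stable-≤ m≤a a≤

  limit< : ∀ a → limit a < r
  limit< a = <-≤-trans (proj₂ (proj₂ (state a)) a) 2h≤r

  -- The terms of a sum equal to the horizon do not exceed it, and up to the horizon `limit`
  -- coincides with the colouring of that stage.
  limit-avoids : ∀ m → Avoids r A limit (horizon (state (suc m)))
  limit-avoids m i i<r xs unique class sum≡ = avoids-step (state m) i i<r xs unique
    (All.zipWith (λ { (le , a∈A , eq) → a∈A , trans (sym (limit-agrees (suc m) (subst (_ ≤_) sum≡ le))) eq })
      (sum-∈-≤ xs , class)) sum≡

  ¬complete : ¬ RamseyComplete r A
  ¬complete complete =
    -- Colours from `2 * h` on, if below `r`, give empty classes, which `IsPartition` allows.
    let P = λ i a → A a × limit a ≡ toℕ i
        N , onwards = complete P record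
          { cover    = (λ {a} a∈A → fromℕ< (limit< a) , a∈A , sym (toℕ-fromℕ< (limit< a))) , (λ (_ , a∈A , _) → a∈A)
          ; disjoint = λ i j i≢j ((_ , eq) , (_ , eq′)) → i≢j (toℕ-injective (trans (sym eq) eq′)) }
        -- The horizon of stage `suc N` exceeds `N`, so completeness would represent a number that
        -- `limit` avoids.
        i , xs , unique , class , sum≡ = onwards (horizon (state (suc N))) (≤-trans (n≤1+n N) (m≤horizon (suc N)))
    in limit-avoids N (toℕ i) (toℕ<n i) xs unique class sum≡

theorem3p5 : (r : ℕ) → 2 ≤ r →
    (A : Pred ℕ 0ℓ) (A? : Decidable A) →
    (∀ a → a ∈ A → 0 < a) →
    (∃[ N ] ∀ n → N ≤ n → count A? n ≤ (r ∸ 1) / 140 ·[log₂ n ]²) →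
    ¬ RamseyComplete r A
theorem3p5 r 2≤r A A? pos (N , sparse) =
  let h , 2h≤r , r≤1+2h = halve r
  in Limit.¬complete A? pos r h (0<half h (≤-trans 2≤r r≤1+2h)) 2h≤r
       (Density.next A? pos r h (0<half h (≤-trans 2≤r r≤1+2h)) 2h≤r r≤1+2h N sparse)
  where
  0<half : ∀ h → 2 ≤ 1 + 2 * h → 0 < h
  0<half zero    (s≤s ())
  0<half (suc _) _ = s≤s z≤n
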